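{- Let $G$ be a finite bipartite graph having a nonempty channel $C$. Then to each perfect matching $\mu$ of $G$ one can assign a nonempty set of edges $S(\mu)\subseteq E$ such that: (i) $S(\mu)$ is a simple cycle of even length; (ii) every second edge of $S(\mu)$ lies in $\mu$; (iii) $S(\mu)$ depends only on the edges of $\mu$ that contain a vertex of $C$; (iv) if $\mu'$ is a perfect matching with $S(\mu)=\mu\oplus\mu'$ (symmetric difference), then $S(\mu')=S(\mu)$.
   Context: A channel of a graph $G=(V,E)$ is a set $C\subseteq V$ such that every vertex of $G$ is adjacent to an even number of vertices of $C$. -}

module Defs where

open import Data.Bool using (Bool; true; false; T; _xor_)
open import Data.Fin using (Fin; toℕ)
open import Data.Fin.Subset using (Subset; _∈_; _∩_; ∣_∣)
open import Data.Nat using (ℕ; suc; _≤_)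
open import Data.Nat.DivMod using (_mod_)
open import Data.Nat.Divisibility using (_∣_)
open import Data.Product using (∃; ∃!; ∃₂; _×_)
open import Data.Sum using (_⊎_)
open import Data.Vec using (tabulate)
open import Function.Bundles using (_⇔_)
open import Function.Definitions using (Injective)
open import Relation.Binary.PropositionalEquality using (_≡_; _≢_; cong₂)
open import Relation.Nullary using (¬_)

-- Finite simple graphs on the vertex set Fin n, by their adjacency matrix.
record Graph (n : ℕ) : Set where
  field
    adj         : Fin n → Fin n → Bool
    symmetric   : ∀ u v → adj u v ≡ adj v u
    irreflexive : ∀ v → adj v v ≡ false

  neighbours : Fin n → Subset n
  neighbours v = tabulate (adj v)

open Graph public using (neighbours)

Bipartite : ∀ {n} → Graph n → Set
Bipartite {n} G =
  ∃ λ (side : Fin n → Bool) → ∀ u v → T (Graph.adj G u v) → side u ≢ side v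

-- Every vertex v of the graph is quantified over, including those in C.
IsChannel : ∀ {n} → Graph n → Subset n → Set
IsChannel G C = ∀ v → 2 ∣ ∣ neighbours G v ∩ C ∣

-- A set of edges of G.  The edge {u, v} is represented by both of the ordered
-- pairs (u, v) and (v, u), so the characteristic function is symmetric.
record EdgeSet {n : ℕ} (G : Graph n) : Set where
  field
    has       : Fin n → Fin n → Bool
    symmetric : ∀ u v → has u v ≡ has v u
    ⊆E        : ∀ u v → T (has u v) → T (Graph.adj G u v)

module _ {n : ℕ} {G : Graph n} where

  infix 4 _≈_
  infixl 6 _⊕_

  Edge∈ : Fin n → Fin n → EdgeSet G → Set
  Edge∈ u v S = T (EdgeSet.has S u v)

  _≈_ : EdgeSet G → EdgeSet G → Set
  S ≈ S′ = ∀ u v → EdgeSet.has S u v ≡ EdgeSet.has S′ u v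

  NonemptyEdges : EdgeSet G → Set
  NonemptyEdges S = ∃₂ λ u v → Edge∈ u v S

  _⊕_ : EdgeSet G → EdgeSet G → EdgeSet G
  S ⊕ S′ = record
    { has       = λ u v → EdgeSet.has S u v xor EdgeSet.has S′ u v
    ; symmetric = λ u v →
        cong₂ _xor_ (EdgeSet.symmetric S u v) (EdgeSet.symmetric S′ u v)
    ; ⊆E        = λ u v → xor-elim (EdgeSet.has S u v) (EdgeSet.has S′ u v)
        (EdgeSet.⊆E S u v) (EdgeSet.⊆E S′ u v)
    }
    where
    xor-elim : ∀ {P : Set} a b → (T a → P) → (T b → P) → T (a xor b) → P
    xor-elim true  false f g _ = f _
    xor-elim false true  f g _ = g _

  -- S and S′ contain the same edges among those having an endpoint in C.
  AgreeAt : Subset n → EdgeSet G → EdgeSet G → Set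
  AgreeAt C S S′ =
    ∀ u v → u ∈ C ⊎ v ∈ C → EdgeSet.has S u v ≡ EdgeSet.has S′ u v

record PerfectMatching {n : ℕ} (G : Graph n) : Set where
  field
    edges  : EdgeSet G
    covers : ∀ v → ∃! _≡_ λ w → Edge∈ v w edges

open PerfectMatching public using (edges)

-- i ↦ i + 1 modulo k
next : ∀ {k} → Fin k → Fin k
next {suc k} i = suc (toℕ i) mod suc k

-- A presentation of S as the edge set of a simple cycle
-- vertex 0, vertex 1, …, vertex (length - 1), vertex 0.
record Cycle {n : ℕ} {G : Graph n} (S : EdgeSet G) : Set where
  field
    length    : ℕ
    length≥3  : 3 ≤ length
    vertex    : Fin length → Fin n
    injective : Injective _≡_ _≡_ vertex
    edges⇔    : ∀ u v → Edge∈ u v S ⇔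
      ∃ λ i → (u ≡ vertex i × v ≡ vertex (next i))
            ⊎ (v ≡ vertex i × u ≡ vertex (next i))

open Cycle public using (length)

-- Of any two consecutive edges of the cycle, exactly one lies in M.  This does
-- not depend on the starting point or the direction of the presentation.
EverySecondEdgeIn : ∀ {n} {G : Graph n} {S : EdgeSet G} →
                    EdgeSet G → Cycle S → Set
EverySecondEdgeIn M c =
  ∀ i → Edge∈ (vertex i) (vertex (next i)) M
      ⇔ (¬ Edge∈ (vertex (next i)) (vertex (next (next i))) M)
  where open Cycle c using (vertex)

{-# OPTIONS --safe #-}
-- For every vertex b fix a fixed-point-free involution of the even set
-- N(b) ∩ C.  Given μ, send c ∈ C to the partner of c in the involution at the
-- mate b of c.  Alternating between "mate" and "partner", start at a fixed
-- vertex of C: the walk runs into a cycle, which is S(μ).  Bipartiteness puts all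
-- visited vertices of C on one side, so that the cycle is simple.  If μ′ = μ ⊕ S(μ),
-- the walk for μ′ agrees with the walk for μ up to its first visit to S(μ), after which
-- it goes round S(μ) backwards because the partner maps are involutions.
module Submission where

open import Defs
open import Data.Bool using (Bool; true; false; T; _xor_)
open import Data.Bool.Properties using (T-≡; T?; ¬-not; not-injective)
open import Data.Empty using (⊥-elim)
open import Data.Fin using (Fin; zero; suc; toℕ)
open import Data.Fin.Properties
  using (_≟_; any?; pigeonhole; suc-injective; toℕ-fromℕ<; toℕ-injective; toℕ<n; toℕ≤pred[n])
open import Data.Fin.Subset using (Subset; Nonempty; inside; outside; _∈_; _∉_; _∩_; ∣_∣)
open import Data.Fin.Subset.Properties using (_∈?_; drop-there; x∈p∩q⁺; x∈p∩q⁻)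
open import Data.Nat using (ℕ; zero; suc; _+_; _*_; _∸_; _≤_; _<_; z≤n; s≤s; NonZero)
open import Data.Nat.Divisibility using (_∣_; _∣0; ∣-refl; ∣1⇒≡1; ∣m∣n⇒∣m+n; ∣m+n∣m⇒∣n; n∣m*n)
open import Data.Nat.DivMod using (_/_; _%_; _mod_; m%n<n; m≡m%n+[m/n]*n)
open import Data.Nat.GeneralisedArithmetic using (fold; fold-+)
open import Data.Nat.Induction using (<-rec)
open import Data.Nat.Properties
  using (anyUpTo?; <-cmp; +-comm; +-assoc; *-cancelʳ-<; m∸n+n≡m; +-monoʳ-<; +-identityʳ; <⇒≤;
         m≤n⇒∃[o]m+o≡n; ≤-refl; *-suc)
open import Data.Product using (Σ; ∃; _×_; _,_; proj₁; proj₂)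
open import Data.Sum using (_⊎_; inj₁; inj₂)
open import Data.Vec using ([]; _∷_; here; there)
open import Data.Vec.Properties using ([]=⇒lookup; lookup⇒[]=; lookup∘tabulate)
open import Function.Base using (_∘_)
open import Function.Bundles using (_⇔_; mk⇔; module Equivalence)
open import Relation.Binary.Definitions using (tri<; tri≈; tri>)
open import Relation.Binary.PropositionalEquality
  using (_≡_; _≢_; refl; sym; trans; cong; subst; subst₂; module ≡-Reasoning)
open import Relation.Nullary using (¬_; Dec; yes; no; contradiction)
open import Relation.Nullary.Decidable using (⌊_⌋; _×-dec_; _⊎-dec_; toWitness; fromWitness)
open import Relation.Unary using (Decidable)

-- Pairings of finite sets of even size

-- The involution acts on all of `Fin n`, so that it can be iterated and reversed without carrying
-- membership proofs.
record Pairing {n : ℕ} (D : Subset n) : Set where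
  field
    partner     : Fin n → Fin n
    involutive  : ∀ x → partner (partner x) ≡ x
    closed      : ∀ {x} → x ∈ D → partner x ∈ D
    irreflexive : ∀ {x} → x ∈ D → partner x ≢ x

-- Being the identity outside `D` forces the map to preserve `D` and lets `D` grow one element at a
-- time.
record Involution {n : ℕ} (D : Subset n) : Set where
  field
    partner    : Fin n → Fin n
    involutive : ∀ x → partner (partner x) ≡ x
    support    : ∀ {x} → x ∉ D → partner x ≡ x

  closed : ∀ {x} → x ∈ D → partner x ∈ D
  closed {x} x∈D with partner x ∈? D
  ... | yes πx∈D = πx∈D
  ... | no  πx∉D = subst (_∈ D) (trans (sym (involutive x)) (support πx∉D)) x∈D

open Involution

FixedPointFree : ∀ {n} {D : Subset n} → Involution D → Set
FixedPointFree {D = D} π = ∀ {x} → x ∈ D → partner π x ≢ x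

-- This is the form that a pairing takes on an odd set: `z` is the one element left over.
UniqueFixedPoint : ∀ {n} {D : Subset n} → Involution D → Fin n → Set
UniqueFixedPoint {D = D} π z = z ∈ D × partner π z ≡ z × (∀ {x} → x ∈ D → partner π x ≡ x → x ≡ z)

lift : ∀ {n} {D : Subset n} s → Involution D → Involution (s ∷ D)
lift {D = D} s π = record { partner = p ; involutive = inv ; support = supp }
  where
  p : Fin _ → Fin _
  p zero    = zero
  p (suc x) = suc (partner π x)
  inv : ∀ x → p (p x) ≡ x
  inv zero    = refl
  inv (suc x) = cong suc (involutive π x)
  supp : ∀ {x} → x ∉ s ∷ D → p x ≡ x
  supp {zero}  _   = refl
  supp {suc x} x∉D = cong suc (support π (x∉D ∘ there))

-- The new element `zero` is swapped with the leftover `z`; all other pairs stay.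
absorb : ∀ {n} {D : Subset n} (π : Involution D) {z} → UniqueFixedPoint π z →
         Σ (Involution (inside ∷ D)) FixedPointFree
absorb {D = D} π {z} (z∈D , πz≡z , unique) =
  record { partner = p ; involutive = inv ; support = supp } , free
  where
  p : Fin _ → Fin _
  p zero = suc z
  p (suc x) with x ≟ z
  ... | yes _ = zero
  ... | no  _ = suc (partner π x)
  p-z : p (suc z) ≡ zero
  p-z with z ≟ z
  ... | yes _   = refl
  ... | no  z≢z = contradiction refl z≢z
  p-≢ : ∀ {x} → x ≢ z → p (suc x) ≡ suc (partner π x)
  p-≢ {x} x≢z with x ≟ z
  ... | yes x≡z = contradiction x≡z x≢z
  ... | no  _   = refl
  inv : ∀ x → p (p x) ≡ x
  inv zero = p-z
  inv (suc x) with x ≟ z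
  ... | yes refl = refl
  ... | no  x≢z  = trans (p-≢ πx≢z) (cong suc (involutive π x))
    where
    πx≢z : partner π x ≢ z
    πx≢z πx≡z = x≢z (trans (sym (involutive π x)) (trans (cong (partner π) πx≡z) πz≡z))
  supp : ∀ {x} → x ∉ inside ∷ D → p x ≡ x
  supp {zero}  x∉D = contradiction here x∉D
  supp {suc x} x∉D = trans (p-≢ λ { refl → x∉D (there z∈D) }) (cong suc (support π (x∉D ∘ there)))
  free : ∀ {x} → x ∈ inside ∷ D → p x ≢ x
  free {suc x} x∈D with x ≟ z
  ... | yes _   = λ ()
  ... | no  x≢z = x≢z ∘ unique (drop-there x∈D) ∘ suc-injective

-- Both parities go through the induction together: an element added to an even set becomes the
-- leftover, and one added to an odd set is matched with the leftover.
involution : ∀ {n} (D : Subset n) →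
  (2 ∣ ∣ D ∣ × Σ (Involution D) FixedPointFree) ⊎
  (2 ∣ suc (∣ D ∣) × Σ (Involution D) λ π → ∃ (UniqueFixedPoint π))
involution [] = inj₁ (2 ∣0 , identity , λ ())
  where
  identity : Involution []
  identity = record { partner = λ x → x ; involutive = λ _ → refl ; support = λ _ → refl }
involution (outside ∷ D) with involution D
... | inj₁ (even , π , free) =
  inj₁ (even , lift outside π , λ { (there x∈D) → free x∈D ∘ suc-injective })
... | inj₂ (odd , π , z , z∈D , πz≡z , unique) =
  inj₂ (odd , lift outside π , suc z , there z∈D , cong suc πz≡z ,
        λ { (there x∈D) → cong suc ∘ unique x∈D ∘ suc-injective })
involution (inside ∷ D) with involution D
... | inj₁ (even , π , free) =
  inj₂ (∣m∣n⇒∣m+n ∣-refl even , lift inside π , zero , here , refl ,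
        λ { here _ → refl ; (there x∈D) πx≡x → contradiction (suc-injective πx≡x) (free x∈D) })
... | inj₂ (odd , π , z , z-unique) = inj₁ (odd , absorb π z-unique)

abstract
  pairing : ∀ {n} (D : Subset n) → 2 ∣ ∣ D ∣ → Pairing D
  pairing D even with involution D
  ... | inj₁ (_ , π , free) = record
    { partner = partner π ; involutive = involutive π ; closed = closed π ; irreflexive = free }
  ... | inj₂ (odd , _) =
    contradiction (∣1⇒≡1 (∣m+n∣m⇒∣n (subst (2 ∣_) (+-comm 1 ∣ D ∣) odd) even)) λ ()

-- Iteration of a self-map of a finite set

least : ∀ {P : ℕ → Set} → Decidable P → ∀ n → P n → ∃ λ m → P m × (∀ {j} → j < m → ¬ P j)
least {P} P? = <-rec _ λ n rec Pn → search n rec Pn (anyUpTo? P? n)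
  where
  search : ∀ n → (∀ {m} → m < n → P m → ∃ λ l → P l × (∀ {j} → j < l → ¬ P j)) → P n →
           Dec (∃ λ m → m < n × P m) → ∃ λ m → P m × (∀ {j} → j < m → ¬ P j)
  search n rec Pn (yes (m , m<n , Pm)) = rec m<n Pm
  search n rec Pn (no none)            = n , Pn , λ {j} j<n Pj → none (j , j<n , Pj)

module _ {A : Set} (f : A → A) where

  fold-pull-step : ∀ x m → fold (f x) f m ≡ f (fold x f m)
  fold-pull-step x zero    = refl
  fold-pull-step x (suc m) = cong f (fold-pull-step x m)

  fold-swap : ∀ x m n → fold (fold x f n) f m ≡ fold (fold x f m) f n
  fold-swap x m n = begin
    fold (fold x f n) f m ≡⟨ fold-+ x f m ⟨
    fold x f (m + n)      ≡⟨ cong (fold x f) (+-comm m n) ⟩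
    fold x f (n + m)      ≡⟨ fold-+ x f n ⟩
    fold (fold x f m) f n ∎
    where open ≡-Reasoning

  fold-periodic : ∀ {x k} → fold x f k ≡ x → ∀ m → fold x f (m * k) ≡ x
  fold-periodic         eq zero    = refl
  fold-periodic {x} {k} eq (suc m) =
    trans (fold-+ x f k) (trans (cong (λ y → fold y f k) (fold-periodic eq m)) eq)

abstract
  -- Two of the iterates `0` to `n` coincide, say `i < j`; applying `f` another `n ∸ i` times moves
  -- the coincidence to iterate `n`. This index is the same for every `f`, so walks for different
  -- matchings can be compared after equally many steps.
  eventually-periodic : ∀ {n} (f : Fin n → Fin n) x →
    ∃ λ p → fold (fold x f n) f (suc p) ≡ fold x f n
  eventually-periodic {n} f x
    with i , j , i<j , fⁱ≡fʲ ← pigeonhole ≤-refl (fold x f ∘ toℕ)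
    with d , 1+i+d≡j ← m≤n⇒∃[o]m+o≡n i<j = d , (begin
      fold (fold x f n) f (suc d)               ≡⟨ cong (λ y → fold y f (suc d)) fⁿ≡ ⟩
      fold (fold fⁱ f (n ∸ toℕ i)) f (suc d)    ≡⟨ fold-swap f fⁱ (suc d) (n ∸ toℕ i) ⟩
      fold (fold fⁱ f (suc d)) f (n ∸ toℕ i)    ≡⟨ cong (λ y → fold y f (n ∸ toℕ i)) fʲ≡ ⟩
      fold fⁱ f (n ∸ toℕ i)                     ≡⟨ fⁿ≡ ⟨
      fold x f n                                ∎)
    where
    open ≡-Reasoning
    fⁱ : Fin n
    fⁱ = fold x f (toℕ i)
    fⁿ≡ : fold x f n ≡ fold fⁱ f (n ∸ toℕ i)
    fⁿ≡ = trans (cong (fold x f) (sym (m∸n+n≡m (toℕ≤pred[n] i)))) (fold-+ x f (n ∸ toℕ i))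
    fʲ≡ : fold fⁱ f (suc d) ≡ fⁱ
    fʲ≡ = begin
      fold fⁱ f (suc d)             ≡⟨ fold-+ x f (suc d) ⟨
      fold x f (suc d + toℕ i)      ≡⟨ cong (fold x f) (trans (cong suc (+-comm d (toℕ i))) 1+i+d≡j) ⟩
      fold x f (toℕ j)              ≡⟨ fⁱ≡fʲ ⟨
      fⁱ                            ∎

-- The period is `suc pred`, hence positive by construction.
record MinimalPeriod {n : ℕ} (f : Fin n → Fin n) (x : Fin n) : Set where
  field
    pred    : ℕ
    returns : fold x f (suc pred) ≡ x
    minimal : ∀ {j} → j < pred → fold x f (suc j) ≢ x

  -- A coincidence at `a < b`, pushed forward until `b` becomes the full period, brings `x` back to
  -- itself too early.
  fold-≢ : ∀ {a b} → a < b → b < suc pred → fold x f a ≢ fold x f b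
  fold-≢ {a} {b} a<b (s≤s b≤p) fᵃ≡fᵇ = minimal p∸b+a<p (begin
    fold x f (suc (pred ∸ b + a))             ≡⟨ fold-+ x f (suc (pred ∸ b)) ⟩
    fold (fold x f a) f (suc (pred ∸ b))      ≡⟨ cong (λ y → fold y f (suc (pred ∸ b))) fᵃ≡fᵇ ⟩
    fold (fold x f b) f (suc (pred ∸ b))      ≡⟨ fold-+ x f (suc (pred ∸ b)) ⟨
    fold x f (suc (pred ∸ b + b))             ≡⟨ cong (fold x f ∘ suc) (m∸n+n≡m b≤p) ⟩
    fold x f (suc pred)                       ≡⟨ returns ⟩
    x                                         ∎)
    where
    open ≡-Reasoning
    p∸b+a<p : pred ∸ b + a < pred
    p∸b+a<p = subst (pred ∸ b + a <_) (m∸n+n≡m b≤p) (+-monoʳ-< (pred ∸ b) a<b)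

  fold-injective : ∀ {a b} → a < suc pred → b < suc pred → fold x f a ≡ fold x f b → a ≡ b
  fold-injective {a} {b} a<k b<k eq with <-cmp a b
  ... | tri< a<b _ _ = contradiction eq (fold-≢ a<b b<k)
  ... | tri≈ _ a≡b _ = a≡b
  ... | tri> _ _ b<a = contradiction (sym eq) (fold-≢ b<a a<k)

abstract
  minimal-period : ∀ {n} (f : Fin n → Fin n) x p → fold x f (suc p) ≡ x → MinimalPeriod f x
  minimal-period f x p eq with q , returns , minimal ← least (λ j → fold x f (suc j) ≟ x) p eq =
    record { pred = q ; returns = returns ; minimal = minimal }

periodic-% : ∀ {A : Set} (g : ℕ → A) k .{{_ : NonZero k}} → (∀ m → g (m + k) ≡ g m) →
             ∀ m → g (m % k) ≡ g m
periodic-% g k periodic m = trans (sym (shift (m / k) (m % k))) (cong g (sym (m≡m%n+[m/n]*n m k)))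
  where
  shift : ∀ q r → g (r + q * k) ≡ g r
  shift zero    r = cong g (+-identityʳ r)
  shift (suc q) r = trans (cong g (sym (+-assoc r k (q * k)))) (trans (shift q (r + k)) (periodic r))

-- Walks along a perfect matching

module _ {n : ℕ} {G : Graph n} (μ : PerfectMatching G) where

  mate : Fin n → Fin n
  mate v = proj₁ (PerfectMatching.covers μ v)

  mate-edge : ∀ v → Edge∈ v (mate v) (edges μ)
  mate-edge v = proj₁ (proj₂ (PerfectMatching.covers μ v))

  mate-unique : ∀ {v w} → Edge∈ v w (edges μ) → mate v ≡ w
  mate-unique {v} = proj₂ (proj₂ (PerfectMatching.covers μ v))

  mate-involutive : ∀ v → mate (mate v) ≡ v
  mate-involutive v = mate-unique (subst T (EdgeSet.symmetric (edges μ) v (mate v)) (mate-edge v))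

  mate-injective : ∀ {u v} → mate u ≡ mate v → u ≡ v
  mate-injective {u} {v} eq =
    trans (sym (mate-involutive u)) (trans (cong mate eq) (mate-involutive v))

-- Parity of positions, Boolean symmetric difference and unordered pairs

EvenOrOdd : ℕ → Set
EvenOrOdd i = ∃ λ q → i ≡ q * 2 ⊎ i ≡ suc (q * 2)

even-or-odd : ∀ i → EvenOrOdd i
even-or-odd zero = 0 , inj₁ refl
even-or-odd (suc i) with even-or-odd i
... | q , inj₁ refl = q , inj₂ refl
... | q , inj₂ refl = suc q , inj₁ refl

odd<even : ∀ {q k} → suc (q * 2) < k * 2 → q < k
odd<even {q} {k} lt = *-cancelʳ-< 2 q k (<⇒≤ lt)

T-ext : ∀ {a b} → (T a → T b) → (T b → T a) → a ≡ b
T-ext {true}  {true}  _ _ = refl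
T-ext {true}  {false} f _ = ⊥-elim (f _)
T-ext {false} {true}  _ g = ⊥-elim (g _)
T-ext {false} {false} _ _ = refl

T-xor : ∀ a b → T a → T b ⊎ T (a xor b)
T-xor true true  _ = inj₁ _
T-xor true false _ = inj₂ _

T-xor-false : ∀ a b → ¬ T a → T (a xor b) → T b
T-xor-false true  _ ¬a _ = ⊥-elim (¬a _)
T-xor-false false _ _  t = t

module _ {n : ℕ} where

  -- Equality of the unordered pairs `{u, v}` and `{a, b}`, spelled exactly as in the field `edges⇔`
  -- of `Cycle`.
  Joins : Fin n → Fin n → Fin n → Fin n → Set
  Joins a b u v = (u ≡ a × v ≡ b) ⊎ (v ≡ a × u ≡ b)

  joins? : ∀ a b u v → Dec (Joins a b u v)
  joins? a b u v = ((u ≟ a) ×-dec (v ≟ b)) ⊎-dec ((v ≟ a) ×-dec (u ≟ b))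

  joins-swap : ∀ {a b u v} → Joins a b u v → Joins a b v u
  joins-swap (inj₁ p) = inj₂ p
  joins-swap (inj₂ p) = inj₁ p

  joins-flip : ∀ {a b u v} → Joins a b u v → Joins b a u v
  joins-flip (inj₁ (p , q)) = inj₂ (q , p)
  joins-flip (inj₂ (p , q)) = inj₁ (q , p)

-- The channel, its pairings and the two sides of the graph

module Channel {n : ℕ} (G : Graph n) (side : Fin n → Bool)
  (bipartite : ∀ u v → T (Graph.adj G u v) → side u ≢ side v)
  (C : Subset n) (channel : IsChannel G C) (start : Fin n) (start∈C : start ∈ C) where

  module At (b : Fin n) = Pairing (pairing (neighbours G b ∩ C) (channel b))

  -- The invariant of the walk: `c` and its successor have a common neighbour, the mate of `c`, and
  -- therefore lie on the same side.
  Good : Fin n → Set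
  Good c = c ∈ C × side c ≡ side start

  adj-sym : ∀ {u v} → T (Graph.adj G u v) → T (Graph.adj G v u)
  adj-sym {u} {v} = subst T (Graph.symmetric G u v)

  ∈-neighbours⁺ : ∀ {u v} → T (Graph.adj G u v) → v ∈ neighbours G u
  ∈-neighbours⁺ {u} {v} uv = lookup⇒[]= v (neighbours G u)
    (trans (lookup∘tabulate (Graph.adj G u) v) (Equivalence.to T-≡ uv))

  ∈-neighbours⁻ : ∀ {u v} → v ∈ neighbours G u → T (Graph.adj G u v)
  ∈-neighbours⁻ {u} {v} v∈ = Equivalence.from T-≡
    (trans (sym (lookup∘tabulate (Graph.adj G u) v)) ([]=⇒lookup v∈))

  same-side : ∀ {u v w} → T (Graph.adj G u v) → T (Graph.adj G v w) → side w ≡ side u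
  same-side {u} {v} {w} uv vw =
    not-injective (trans (sym (¬-not (bipartite v w vw)))
                         (¬-not (bipartite v u (adj-sym uv))))

  -- The walk for one matching and the cycle that it runs into

  module Walk (μ : PerfectMatching G) where

    f : Fin n → Fin n
    f c = At.partner (mate μ c) c

    mate-adj : ∀ c → T (Graph.adj G c (mate μ c))
    mate-adj c = EdgeSet.⊆E (edges μ) c (mate μ c) (mate-edge μ c)

    mate-side : ∀ c → side c ≢ side (mate μ c)
    mate-side c = bipartite c (mate μ c) (mate-adj c)

    ∈-pairing : ∀ {c} → c ∈ C → c ∈ neighbours G (mate μ c) ∩ C
    ∈-pairing {c} c∈C = x∈p∩q⁺ (∈-neighbours⁺ (adj-sym (mate-adj c)) , c∈C)

    f-closed : ∀ {c} → c ∈ C → f c ∈ neighbours G (mate μ c) × f c ∈ C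
    f-closed {c} c∈C = x∈p∩q⁻ _ _ (At.closed (mate μ c) (∈-pairing c∈C))

    f-adj : ∀ {c} → c ∈ C → T (Graph.adj G (mate μ c) (f c))
    f-adj c∈C = ∈-neighbours⁻ (proj₁ (f-closed c∈C))

    f-good : ∀ {c} → Good c → Good (f c)
    f-good {c} (c∈C , eq) =
      proj₂ (f-closed c∈C) , trans (same-side (mate-adj c) (f-adj c∈C)) eq

    f-≢ : ∀ {c} → c ∈ C → f c ≢ c
    f-≢ {c} c∈C = At.irreflexive (mate μ c) (∈-pairing c∈C)

    fold-good : ∀ {c} → Good c → ∀ m → Good (fold c f m)
    fold-good good zero    = good
    fold-good good (suc m) = f-good (fold-good good m)

    -- Otherwise `f c` would be the mate of `mate μ c`, that is `c`, but partners are distinct.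
    f-∉μ : ∀ {c} → c ∈ C → ¬ Edge∈ (mate μ c) (f c) (edges μ)
    f-∉μ {c} c∈C e = f-≢ c∈C (trans (sym (mate-unique μ e)) (mate-involutive μ c))

    -- After `n` steps the walk is certainly on its cycle.
    base : Fin n
    base = fold start f n

    base-good : Good base
    base-good = fold-good (start∈C , refl) n

    base-period : MinimalPeriod f base
    base-period with p , returns ← eventually-periodic f start = minimal-period f base p returns

    open MinimalPeriod base-period public

    -- Each step of `f` is split into its two edges: even positions are iterates of `f`, odd
    -- positions are their mates. Recursion by two positions moves the starting point, so edge
    -- properties need checking only at positions 0 and 1.
    walk : Fin n → ℕ → Fin n
    walk c zero          = c
    walk c (suc zero)    = mate μ c
    walk c (suc (suc m)) = walk (f c) m

    walk-even : ∀ c q → walk c (q * 2) ≡ fold c f q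
    walk-even c zero    = refl
    walk-even c (suc q) = trans (walk-even (f c) q) (fold-pull-step f c q)

    walk-odd : ∀ c q → walk c (suc (q * 2)) ≡ mate μ (fold c f q)
    walk-odd c zero    = refl
    walk-odd c (suc q) = trans (walk-odd (f c) q) (cong (mate μ) (fold-pull-step f c q))

    walk-+ : ∀ c q m → walk c (q * 2 + m) ≡ walk (fold c f q) m
    walk-+ c zero    m = refl
    walk-+ c (suc q) m = trans (walk-+ (f c) q m) (cong (λ y → walk y m) (fold-pull-step f c q))

    K : ℕ
    K = suc pred * 2

    walk-periodic : ∀ m → walk base (m + K) ≡ walk base m
    walk-periodic m = trans (cong (walk base) (+-comm m K))
      (trans (walk-+ base (suc pred) m) (cong (λ y → walk y m) returns))

    walk-adj : ∀ {c} → Good c → ∀ m → T (Graph.adj G (walk c m) (walk c (suc m)))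
    walk-adj {c} good zero          = mate-adj c
    walk-adj     good (suc zero)    = f-adj (proj₁ good)
    walk-adj     good (suc (suc m)) = walk-adj (f-good good) m

    walk-alternates : ∀ {c} → Good c → ∀ m →
      Edge∈ (walk c m) (walk c (suc m)) (edges μ) ⇔
      (¬ Edge∈ (walk c (suc m)) (walk c (suc (suc m))) (edges μ))
    walk-alternates {c} good zero =
      mk⇔ (λ _ → f-∉μ (proj₁ good)) (λ _ → mate-edge μ c)
    walk-alternates {c} good (suc zero) =
      mk⇔ (λ e → ⊥-elim (f-∉μ (proj₁ good) e)) (λ ¬e → ⊥-elim (¬e (mate-edge μ (f c))))
    walk-alternates good (suc (suc m)) = walk-alternates (f-good good) m

    Orbit : Fin n → Set
    Orbit c = ∃ λ q → c ≡ fold base f q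

    orbit-good : ∀ {c} → Orbit c → Good c
    orbit-good (q , refl) = fold-good base-good q

    -- This is where bipartiteness keeps even and odd positions of the walk apart.
    good≢mate : ∀ {c d} → Good c → Orbit d → c ≢ mate μ d
    good≢mate {d = d} good o c≡ = mate-side d
      (trans (proj₂ (orbit-good o)) (trans (sym (proj₂ good)) (cong side c≡)))

    -- Positions of equal parity are separated by minimality of the period, after cancelling `mate`
    -- if they are odd; positions of different parity lie on different sides.
    walk-injective : ∀ {i j} → i < K → j < K → walk base i ≡ walk base j → i ≡ j
    walk-injective {i} {j} i<K j<K eq with even-or-odd i | even-or-odd j
    ... | q , inj₁ refl | r , inj₁ refl =
      cong (_* 2) (fold-injective (*-cancelʳ-< 2 q _ i<K) (*-cancelʳ-< 2 r _ j<K)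
        (trans (sym (walk-even base q)) (trans eq (walk-even base r))))
    ... | q , inj₂ refl | r , inj₂ refl =
      cong (λ m → suc (m * 2)) (fold-injective (odd<even {q} i<K) (odd<even {r} j<K)
        (mate-injective μ (trans (sym (walk-odd base q)) (trans eq (walk-odd base r)))))
    ... | q , inj₁ refl | r , inj₂ refl =
      ⊥-elim (good≢mate (fold-good base-good q) (r , refl)
        (trans (sym (walk-even base q)) (trans eq (walk-odd base r))))
    ... | q , inj₂ refl | r , inj₁ refl =
      ⊥-elim (good≢mate (fold-good base-good r) (q , refl)
        (trans (sym (walk-even base r)) (trans (sym eq) (walk-odd base q))))

    vertex : Fin K → Fin n
    vertex i = walk base (toℕ i)

    vertex-mod : ∀ m → vertex (m mod K) ≡ walk base m
    vertex-mod m = trans (cong (walk base) (toℕ-fromℕ< (m%n<n m K)))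
                         (periodic-% (walk base) K walk-periodic m)

    vertex-next : ∀ i → vertex (next i) ≡ walk base (suc (toℕ i))
    vertex-next i = vertex-mod (suc (toℕ i))

    vertex-next-mod : ∀ m → vertex (next (m mod K)) ≡ walk base (suc m)
    vertex-next-mod m = trans (vertex-next (m mod K))
      (trans (cong (walk base ∘ suc) (toℕ-fromℕ< (m%n<n m K)))
             (periodic-% (walk base ∘ suc) K (walk-periodic ∘ suc) m))

    vertex-next² : ∀ i → vertex (next (next i)) ≡ walk base (suc (suc (toℕ i)))
    -- `next i` is by definition `suc (toℕ i) mod K`.
    vertex-next² i = vertex-next-mod (suc (toℕ i))

    OnCycle : Fin n → Fin n → Set
    OnCycle u v = ∃ λ i → Joins (vertex i) (vertex (next i)) u v

    abstract
      onCycle? : ∀ u v → Dec (OnCycle u v)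
      onCycle? u v = any? λ i → joins? (vertex i) (vertex (next i)) u v

    onCycle-swap : ∀ {u v} → OnCycle u v → OnCycle v u
    onCycle-swap (i , j) = i , joins-swap j

    S : EdgeSet G
    S = record
      { has       = λ u v → ⌊ onCycle? u v ⌋
      ; symmetric = λ u v → T-ext (fromWitness ∘ onCycle-swap ∘ toWitness)
                                  (fromWitness ∘ onCycle-swap ∘ toWitness)
      ; ⊆E        = λ u v → adjacent ∘ toWitness
      }
      where
      step : ∀ i → T (Graph.adj G (vertex i) (vertex (next i)))
      step i = subst (λ w → T (Graph.adj G (vertex i) w)) (sym (vertex-next i))
                     (walk-adj base-good (toℕ i))
      adjacent : ∀ {u v} → OnCycle u v → T (Graph.adj G u v)
      adjacent (i , inj₁ (refl , refl)) = step i
      adjacent (i , inj₂ (refl , refl)) = adj-sym (step i)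

    -- Period one would make `base` its own partner.
    4≤K : 4 ≤ K
    4≤K with pred | returns
    ... | zero  | eq = ⊥-elim (f-≢ (proj₁ base-good) eq)
    ... | suc _ | _  = s≤s (s≤s (s≤s (s≤s z≤n)))

    cycle : Cycle S
    cycle = record
      { length    = K
      ; length≥3  = <⇒≤ 4≤K
      ; vertex    = vertex
      ; injective = λ {i} {j} eq → toℕ-injective (walk-injective (toℕ<n i) (toℕ<n j) eq)
      ; edges⇔    = λ u v → mk⇔ toWitness fromWitness
      }

    alternating : EverySecondEdgeIn (edges μ) cycle
    alternating i = subst₂
      (λ v w → Edge∈ (vertex i) v (edges μ) ⇔ (¬ Edge∈ v w (edges μ)))
      (sym (vertex-next i)) (sym (vertex-next² i)) (walk-alternates base-good (toℕ i))

    -- The matching edge at `c` and the edge that follows it. As `c` runs over the orbit these make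
    -- up `S`, which frees later arguments from indices modulo `K`.
    Segment : Fin n → Fin n → Fin n → Set
    Segment c u v = Joins c (mate μ c) u v ⊎ Joins (mate μ c) (f c) u v

    edge⇒segment : ∀ {u v} → Edge∈ u v S → ∃ λ c → Orbit c × Segment c u v
    edge⇒segment {u} {v} e with toWitness e
    ... | i , joins with even-or-odd (toℕ i)
    ...   | q , inj₁ i≡ = fold base f q , (q , refl) , inj₁ (subst₂ (λ a b → Joins a b u v)
      (trans (cong (walk base) i≡) (walk-even base q))
      (trans (vertex-next i) (trans (cong (walk base ∘ suc) i≡) (walk-odd base q))) joins)
    ...   | q , inj₂ i≡ = fold base f q , (q , refl) , inj₂ (subst₂ (λ a b → Joins a b u v)
      (trans (cong (walk base) i≡) (walk-odd base q))
      (trans (vertex-next i) (trans (cong (walk base ∘ suc) i≡) (walk-even base (suc q)))) joins)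

    segment⇒edge : ∀ {c u v} → Orbit c → Segment c u v → Edge∈ u v S
    segment⇒edge {u = u} {v} (q , refl) (inj₁ joins) =
      -- The exponent `q` may exceed the period, hence the reduction modulo `K`.
      fromWitness ((q * 2) mod K , subst₂ (λ a b → Joins a b u v)
        (sym (trans (vertex-mod (q * 2)) (walk-even base q)))
        (sym (trans (vertex-next-mod (q * 2)) (walk-odd base q))) joins)
    segment⇒edge {u = u} {v} (q , refl) (inj₂ joins) =
      fromWitness (suc (q * 2) mod K , subst₂ (λ a b → Joins a b u v)
        (sym (trans (vertex-mod (suc (q * 2))) (walk-odd base q)))
        (sym (trans (vertex-next-mod (suc (q * 2))) (walk-even base (suc q)))) joins)

    -- An endpoint of an edge of `S` is an orbit vertex or the mate of one, and the sides exclude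
    -- the latter for a good `c`.
    mate-edge⇒orbit : ∀ {c} → Good c → Edge∈ c (mate μ c) S → Orbit c
    mate-edge⇒orbit {c} good e with edge⇒segment e
    ... | d , o , inj₁ (inj₁ (refl , _)) = o
    ... | d , o , inj₁ (inj₂ (_ , c≡)) = ⊥-elim (good≢mate good o c≡)
    ... | d , o , inj₂ (inj₁ (c≡ , _)) = ⊥-elim (good≢mate good o c≡)
    ... | d , (q , d≡) , inj₂ (inj₂ (_ , refl)) = suc q , cong f d≡

    orbit-predecessor : ∀ {c} → Orbit c → ∃ λ d → Orbit d × f d ≡ c
    orbit-predecessor (zero  , refl) = fold base f pred , (pred , refl) , returns
    orbit-predecessor (suc q , refl) = fold base f q , (q , refl) , refl

    orbit-transitive : ∀ {c d} → Orbit c → Orbit d → ∃ λ m → d ≡ fold c f m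
    -- From iterate `q`, another `q * pred` steps complete `q` full periods and lead to `base`; then
    -- `r` steps remain.
    orbit-transitive {c} (q , refl) (r , refl) = r + q * pred , sym (begin
      fold c f (r + q * pred)          ≡⟨ fold-+ c f r ⟩
      fold (fold c f (q * pred)) f r   ≡⟨ cong (λ y → fold y f r) home ⟩
      fold base f r                    ∎)
      where
      open ≡-Reasoning
      home : fold c f (q * pred) ≡ base
      home = begin
        fold c f (q * pred)           ≡⟨ fold-+ base f (q * pred) ⟨
        fold base f (q * pred + q)    ≡⟨ cong (fold base f) (+-comm (q * pred) q) ⟩
        fold base f (q + q * pred)    ≡⟨ cong (fold base f) (*-suc q pred) ⟨
        fold base f (q * suc pred)    ≡⟨ fold-periodic f returns q ⟩
        base                          ∎

  -- Dependence on the matching edges at the channel only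

  module Local (μ μ′ : PerfectMatching G) (agree : AgreeAt C (edges μ) (edges μ′)) where
    private
      module W  = Walk μ
      module W′ = Walk μ′

    mate-≡ : ∀ {c} → c ∈ C → mate μ c ≡ mate μ′ c
    mate-≡ {c} c∈C = mate-unique μ
      (subst T (sym (agree c (mate μ′ c) (inj₁ c∈C))) (mate-edge μ′ c))

    f-≡ : ∀ {c} → c ∈ C → W.f c ≡ W′.f c
    f-≡ {c} c∈C = cong (λ b → At.partner b c) (mate-≡ c∈C)

    fold-≡ : ∀ {c} → Good c → ∀ m → fold c W.f m ≡ fold c W′.f m
    fold-≡ good zero    = refl
    fold-≡ good (suc m) = trans (f-≡ (proj₁ (W.fold-good good m))) (cong W′.f (fold-≡ good m))

    base-≡ : W.base ≡ W′.base
    base-≡ = fold-≡ (start∈C , refl) n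

    orbit-⊆ : ∀ {c} → W.Orbit c → W′.Orbit c
    orbit-⊆ (q , c≡) = q ,
      trans c≡ (trans (fold-≡ W.base-good q) (cong (λ y → fold y W′.f q) base-≡))

    -- Orbit vertices lie in `C`, where the two matchings have the same mates and hence the same
    -- successors.
    S-⊆ : ∀ {u v} → Edge∈ u v W.S → Edge∈ u v W′.S
    S-⊆ {u} {v} e with c , o , seg ← W.edge⇒segment e =
      W′.segment⇒edge (orbit-⊆ o)
        (subst₂ (λ b d → Joins c b u v ⊎ Joins b d u v) (mate-≡ c∈C) (f-≡ c∈C) seg)
      where c∈C = proj₁ (W.orbit-good o)

  -- Invariance under switching the matching along its cycle

  module Reversal (μ μ′ : PerfectMatching G)
    (S≈ : Walk.S μ ≈ edges μ ⊕ edges μ′) where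
    private
      module W  = Walk μ
      module W′ = Walk μ′

    -- An edge of `μ` outside the symmetric difference belongs to `μ′` as well.
    mate-off : ∀ {c} → ¬ Edge∈ c (mate μ c) W.S → mate μ′ c ≡ mate μ c
    mate-off {c} ∉S with T-xor (EdgeSet.has (edges μ) c (mate μ c))
                               (EdgeSet.has (edges μ′) c (mate μ c)) (mate-edge μ c)
    ... | inj₁ ∈μ′ = mate-unique μ′ ∈μ′
    ... | inj₂ ∈⊕  = ⊥-elim (∉S (subst T (sym (S≈ c (mate μ c))) ∈⊕))

    -- The edge from `mate μ c` to `f c` is in `S` but not in `μ`, so it is in `μ′`.
    mate-on : ∀ {c} → W.Orbit c → mate μ′ (W.f c) ≡ mate μ c
    mate-on {c} o =
      trans (cong (mate μ′) (sym (mate-unique μ′ ∈μ′))) (mate-involutive μ′ (mate μ c))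
      where
      ∈μ′ : Edge∈ (mate μ c) (W.f c) (edges μ′)
      ∈μ′ = T-xor-false _ _ (W.f-∉μ (proj₁ (W.orbit-good o)))
        (subst T (S≈ (mate μ c) (W.f c)) (W.segment⇒edge o (inj₂ (inj₁ (refl , refl)))))

    -- Both steps use the involution at the same vertex `mate μ c`, so the second undoes the first.
    f-reverses : ∀ {c} → W.Orbit c → W′.f (W.f c) ≡ c
    f-reverses {c} o = trans (cong (λ b → At.partner b (W.f c)) (mate-on o))
                             (At.involutive (mate μ c) c)

    f′-orbit : ∀ {c} → W.Orbit c → W.Orbit (W′.f c)
    f′-orbit o with d , o′ , refl ← W.orbit-predecessor o = subst W.Orbit (sym (f-reverses o′)) o′

    fold-f′-orbit : ∀ {c} → W.Orbit c → ∀ m → W.Orbit (fold c W′.f m)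
    fold-f′-orbit o zero    = o
    fold-f′-orbit o (suc m) = f′-orbit (fold-f′-orbit o m)

    fold-reverses : ∀ {c} → W.Orbit c → ∀ m → fold (fold c W.f m) W′.f m ≡ c
    fold-reverses         o       zero    = refl
    fold-reverses {c} (q , c≡) (suc m) = begin
      W′.f (fold (W.f (fold c W.f m)) W′.f m)  ≡⟨ fold-pull-step W′.f _ m ⟨
      fold (W′.f (W.f (fold c W.f m))) W′.f m  ≡⟨ cong (λ y → fold y W′.f m) (f-reverses orbitᵐ) ⟩
      fold (fold c W.f m) W′.f m               ≡⟨ fold-reverses (q , c≡) m ⟩
      c                                        ∎
      where
      open ≡-Reasoning
      orbitᵐ : W.Orbit (fold c W.f m)
      orbitᵐ = m + q , trans (cong (λ y → fold y W.f m) c≡) (sym (fold-+ W.base W.f m))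

    -- If the matching edge at the current vertex avoids `S`, both walks take the same step;
    -- otherwise the vertex is on the orbit, which `W′.f` never leaves.
    follows-until-orbit : ∀ m →
      W.Orbit (fold start W′.f m) ⊎ fold start W′.f m ≡ fold start W.f m
    follows-until-orbit zero = inj₂ refl
    follows-until-orbit (suc m) with follows-until-orbit m
    ... | inj₁ o = inj₁ (f′-orbit o)
    ... | inj₂ eq with T? (EdgeSet.has W.S (fold start W.f m) (mate μ (fold start W.f m)))
    ...   | yes ∈S = inj₁ (f′-orbit (subst W.Orbit (sym eq)
                       (W.mate-edge⇒orbit (W.fold-good (start∈C , refl) m) ∈S)))
    ...   | no  ∉S = inj₂ (trans (cong W′.f eq)
                       (cong (λ b → At.partner b (fold start W.f m)) (mate-off ∉S)))

    base′-orbit : W.Orbit W′.base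
    base′-orbit with follows-until-orbit n
    ... | inj₁ o  = o
    -- Walks that agree for all `n` steps both end in `W.base`, which is on the orbit.
    ... | inj₂ eq = 0 , eq

    orbit′⊆orbit : ∀ {c} → W′.Orbit c → W.Orbit c
    orbit′⊆orbit (q , refl) = fold-f′-orbit base′-orbit q

    -- If `m` steps of `W.f` lead from `c` to `W′.base`, then `m` steps of `W′.f` lead back.
    orbit⊆orbit′ : ∀ {c} → W.Orbit c → W′.Orbit c
    orbit⊆orbit′ o with m , eq ← W.orbit-transitive o base′-orbit =
      m , sym (trans (cong (λ y → fold y W′.f m) eq) (fold-reverses o m))

    -- The two edges of the walk for μ around mate c, in reverse order, are those
    -- of the walk for μ′ that starts at f c.
    segment⇔segment′ : ∀ {c u v} → W.Orbit c → W.Segment c u v ⇔ W′.Segment (W.f c) u v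
    segment⇔segment′ {c} {u} {v} o = mk⇔
      (λ { (inj₁ j) → inj₂ (joins-subst (sym (mate-on o)) (sym (f-reverses o)) (joins-flip j))
         ; (inj₂ j) → inj₁ (joins-substʳ (sym (mate-on o)) (joins-flip j)) })
      (λ { (inj₁ j) → inj₂ (joins-flip (joins-substʳ (mate-on o) j))
         ; (inj₂ j) → inj₁ (joins-flip (joins-subst (mate-on o) (f-reverses o) j)) })
      where
      joins-subst : ∀ {a a′ b b′} → a ≡ a′ → b ≡ b′ → Joins a b u v → Joins a′ b′ u v
      joins-subst = subst₂ (λ a b → Joins a b u v)
      joins-substʳ : ∀ {b b′} → b ≡ b′ → Joins (W.f c) b u v → Joins (W.f c) b′ u v
      joins-substʳ = joins-subst refl

    S-reverses : W′.S ≈ W.S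
    S-reverses u v = T-ext to from
      where
      to : Edge∈ u v W′.S → Edge∈ u v W.S
      to e with c , o′ , seg′ ← W′.edge⇒segment e
           with d , o , refl ← W.orbit-predecessor (orbit′⊆orbit o′) =
        W.segment⇒edge o (Equivalence.from (segment⇔segment′ o) seg′)
      from : Edge∈ u v W.S → Edge∈ u v W′.S
      from e with c , (q , c≡) , seg ← W.edge⇒segment e =
        W′.segment⇒edge (orbit⊆orbit′ (suc q , cong W.f c≡))
                        (Equivalence.to (segment⇔segment′ (q , c≡)) seg)

theorem5p2 : ∀ {n : ℕ} (G : Graph n) → Bipartite G →
    (C : Subset n) → IsChannel G C → Nonempty C →
    Σ (PerfectMatching G → EdgeSet G) λ S →
    (∀ μ → NonemptyEdges (S μ)) ×
    (∀ μ → Σ (Cycle (S μ)) λ c →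
    (2 ∣ length c) × EverySecondEdgeIn (edges μ) c) ×
    (∀ μ μ′ → AgreeAt C (edges μ) (edges μ′) → S μ ≈ S μ′) ×
    (∀ μ μ′ → S μ ≈ edges μ ⊕ edges μ′ → S μ′ ≈ S μ)
theorem5p2 G (side , bipartite) C channel (start , start∈C) =
    Walk.S
  -- The matching edge at `base` witnesses nonemptiness.
  , (λ μ → Walk.base μ , mate μ (Walk.base μ) ,
           Walk.segment⇒edge μ (0 , refl) (inj₁ (inj₁ (refl , refl))))
  , (λ μ → Walk.cycle μ , n∣m*n (suc (Walk.pred μ)) , Walk.alternating μ)
  , (λ μ μ′ agree u v → T-ext (Local.S-⊆ μ μ′ agree)
                              (Local.S-⊆ μ′ μ (λ u v uv → sym (agree u v uv))))
  , Reversal.S-reverses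
  where open Channel G side bipartite C channel start start∈C
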